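{- Let $(S_i)_{i\geq 0}$ be an infinite sequence of numerical semigroups such that for each $i$, $S_i=S_{i+1}\cup\{F(S_{i+1})\}$, and such that for at least one $i$ we have $m(S_i)<F(S_i)$. Then the sequence of types $t(S_i)$ is eventually constant.
   Context: $\mathbb{N}=\{0,1,2,\dots\}$. A numerical semigroup is a subset $S\subseteq\mathbb{N}$ containing $0$, closed under addition, with finite complement in $\mathbb{N}$. The elements of $\mathbb{N}\setminus S$ are the gaps of $S$; for $S\neq\mathbb{N}$ the Frobenius number $F(S)$ is the largest gap (so in the sequence $S_{i+1}\neq\mathbb{N}$ for all $i$; $F(\mathbb{N})=-1$ by convention); the multiplicity $m(S)$ is the smallest nonzero element of $S$. The set of pseudo-Frobenius numbers is $PF(S)=\{x\in\mathbb{N}\setminus S \mid x+s\in S \text{ for all } s\in S\setminus\{0\}\}$, and the type is $t(S)=|PF(S)|$. -}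

module Defs where

open import Data.Integer.Base using (ℤ; +_; -[1+_])
open import Data.List.Base using (List; length)
open import Data.List.Relation.Unary.Unique.Propositional using (Unique)
open import Data.Nat.Base using (ℕ; _+_; _≤_; _≥_)
open import Data.Product.Base using (_×_; ∃-syntax)
open import Function.Bundles using (_⇔_)
open import Level using (0ℓ)
open import Relation.Binary.PropositionalEquality.Core using (_≡_; _≢_)
open import Relation.Unary using (Pred; _∈_; _∉_; ∁)
import Data.List.Membership.Propositional as List

-- |P| = k: the elements of P are listed, without repetition, by a list of
-- length k.
HasCardinality : Pred ℕ 0ℓ → ℕ → Set
HasCardinality P k =
  ∃[ xs ] Unique xs × length xs ≡ k × (∀ x → (x List.∈ xs) ⇔ (x ∈ P))

Finite : Pred ℕ 0ℓ → Set
Finite P = ∃[ k ] HasCardinality P k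

record IsNumericalSemigroup (S : Pred ℕ 0ℓ) : Set where
  field
    0∈S      : 0 ∈ S
    +-closed : ∀ {x y} → x ∈ S → y ∈ S → x + y ∈ S
    cofinite : Finite (∁ S)

-- F, m and t are given by their graphs, since a subset of ℕ need not have
-- decidable membership: IsFrobenius S f is F(S) = f, IsMultiplicity S m is
-- m(S) = m, and HasType S k is t(S) = k.

data IsFrobenius (S : Pred ℕ 0ℓ) : ℤ → Set where
  largestGap : ∀ {f} → f ∉ S → (∀ x → x ∉ S → x ≤ f) → IsFrobenius S (+ f)
  noGap      : (∀ x → x ∈ S) → IsFrobenius S -[1+ 0 ]

record IsMultiplicity (S : Pred ℕ 0ℓ) (m : ℕ) : Set where
  field
    m∈S   : m ∈ S
    m≢0   : m ≢ 0
    least : ∀ s → s ∈ S → s ≢ 0 → m ≤ s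

PF : Pred ℕ 0ℓ → Pred ℕ 0ℓ
PF S x = x ∉ S × (∀ s → s ∈ S → s ≢ 0 → x + s ∈ S)

HasType : Pred ℕ 0ℓ → ℕ → Set
HasType S k = HasCardinality (PF S) k

EventuallyConstant : (ℕ → ℕ) → Set
EventuallyConstant t = ∃[ N ] ∀ n → n ≥ N → t n ≡ t N

{-# OPTIONS --safe #-}
module Submission where

-- Let T be the intersection of the S i and m the multiplicity of a term with
-- m < F(S i). The numbers removed afterwards increase and exceed m, so m stays
-- in T, and S (i + 1) consists of T and all numbers above F = F(S (i + 1)).
-- Since T is closed under adding m, membership in T is m-periodic from some N
-- on. Once F is large compared with N and m, the pseudo-Frobenius numbers of
-- S (i + 1) are those of T, which lie below N, and the numbers outside T in the
-- window (F - m, F]; by periodicity the number of the latter does not depend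
-- on i.

open import Axiom.ExcludedMiddle using (ExcludedMiddle)
open import Data.Integer.Base using (+_; _<_)
open import Data.Nat.Base using (ℕ; suc)
open import Data.Product.Base using (_×_; ∃-syntax)
open import Level using (0ℓ)
open import Relation.Unary using (Pred; _≐_; _∪_; ｛_｝)
open import Defs

open import Data.Integer.Base using (+<+)
open import Data.List.Base using (List; []; _∷_; [_]; _++_; _∷ʳ_; length; map; filter; applyUpTo; upTo)
import Data.List.Membership.Propositional as List
open import Data.List.Membership.Propositional.Properties
  using (∈-++⁺ˡ; ∈-++⁺ʳ; ∈-++⁻; ∈-filter⁺; ∈-filter⁻; ∈-applyUpTo⁺; ∈-applyUpTo⁻; ∈-upTo⁺)
open import Data.List.Membership.Propositional.Properties.WithK using (unique∧set⇒bag)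
open import Data.List.Properties
  using (applyUpTo-∷ʳ; filter-++; length-++; length-++-comm; map-cong; map-upTo)
open import Data.List.Relation.Binary.BagAndSetEquality using (∼bag⇒↭)
open import Data.List.Relation.Binary.Permutation.Propositional.Properties using (↭-length)
open import Data.List.Relation.Unary.Unique.Propositional using (Unique)
import Data.List.Relation.Unary.Unique.Propositional.Properties as Unique
open import Data.Nat.Base as ℕ using (zero; _+_; _*_; _∸_; _⊔_; _≤_; _≥_; NonZero; ≢-nonZero; s≤s; z≤n)
open import Data.Nat.DivMod using (_/_; _%_; m≡m%n+[m/n]*n; m%n<n; m*n/n≡m; /-monoˡ-≤)
open import Data.Nat.Properties
open import Data.Product.Base using (_,_; proj₁; proj₂; swap)
open import Data.Sum.Base using (inj₁; inj₂; [_,_]′)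
open import Function.Base using (_∘_; id)
open import Function.Bundles using (_⇔_; mk⇔; module Equivalence)
open import Relation.Binary.PropositionalEquality hiding ([_])
open import Relation.Nullary using (¬_; yes; no; contradiction)
open import Relation.Unary using (_∈_; _∉_; ∁; _⊆_; ⋂; Decidable)

open Equivalence using (to; from)

private
  variable
    P Q : Pred ℕ 0ℓ
    a b m : ℕ

-- Finite cardinalities

HasCardinality-resp-≐ : P ≐ Q → HasCardinality P a → HasCardinality Q a
HasCardinality-resp-≐ (P⊆Q , Q⊆P) (xs , uniq , len , mem) =
  xs , uniq , len , λ x → mk⇔ (P⊆Q ∘ to (mem x)) (from (mem x) ∘ Q⊆P)

-- Two duplicate-free lists with the same members are permutations of each other.
HasCardinality-unique : HasCardinality P a → HasCardinality P b → a ≡ b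
HasCardinality-unique (xs , xs! , refl , memˣ) (ys , ys! , refl , memʸ) =
  ↭-length (∼bag⇒↭ (unique∧set⇒bag xs! ys!
    (λ {x} → mk⇔ (from (memʸ x) ∘ to (memˣ x)) (from (memˣ x) ∘ to (memʸ x)))))

HasCardinality-∪ : (∀ {x} → x ∈ P → x ∉ Q) →
  HasCardinality P a → HasCardinality Q b → HasCardinality (P ∪ Q) (a + b)
HasCardinality-∪ disjoint (xs , xs! , refl , memˣ) (ys , ys! , refl , memʸ) =
  xs ++ ys ,
  Unique.++⁺ xs! ys! (λ (∈xs , ∈ys) → disjoint (to (memˣ _) ∈xs) (to (memʸ _) ∈ys)) ,
  length-++ xs ,
  λ x → mk⇔
    ([ inj₁ ∘ to (memˣ x) , inj₂ ∘ to (memʸ x) ]′ ∘ ∈-++⁻ xs)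
    [ ∈-++⁺ˡ ∘ from (memˣ x) , ∈-++⁺ʳ xs ∘ from (memʸ x) ]′

filter-HasCardinality : (P? : Decidable P) (xs : List ℕ) → Unique xs →
  HasCardinality (λ x → x List.∈ xs × x ∈ P) (length (filter P? xs))
filter-HasCardinality P? xs xs! =
  filter P? xs , Unique.filter⁺ P? xs! , refl ,
  λ x → mk⇔ (∈-filter⁻ P?) (λ (x∈xs , Px) → ∈-filter⁺ P? x∈xs Px)

⊆-finite : Decidable P → P ⊆ Q → Finite Q → Finite P
⊆-finite P? P⊆Q (_ , xs , xs! , _ , mem) =
  _ , HasCardinality-resp-≐ (proj₂ , λ {x} Px → from (mem x) (P⊆Q Px) , Px)
        (filter-HasCardinality P? xs xs!)

-- Counting in a window of one period

module _ (P? : Decidable P) where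

  count : (ℕ → ℕ) → ℕ → ℕ
  count f n = length (filter P? (applyUpTo f n))

  count-cong : ∀ {f g} → f ≗ g → count f ≗ count g
  count-cong {f} {g} f≗g n = cong (length ∘ filter P?) (begin
    applyUpTo f n   ≡⟨ map-upTo f n ⟨
    map f (upTo n)  ≡⟨ map-cong f≗g (upTo n) ⟩
    map g (upTo n)  ≡⟨ map-upTo g n ⟩
    applyUpTo g n   ∎)
    where open ≡-Reasoning

  -- Sliding the window by one step drops `f 0` and gains `f m`, which `P` treats alike. Adding the
  -- contribution of `f m` to both sides makes each count the values `f 0`, ..., `f m`.
  count-suc : ∀ f m → f 0 ∈ P ⇔ f m ∈ P → count f m ≡ count (f ∘ suc) m
  count-suc f m P₀⇔Pₘ = +-cancelʳ-≡ (length (filter P? [ f m ])) _ _ (begin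
    count f m + length (filter P? [ f m ])
      ≡⟨ length-++ (filter P? (applyUpTo f m)) ⟨
    length (filter P? (applyUpTo f m) ++ filter P? [ f m ])
      ≡⟨ cong length (filter-++ P? (applyUpTo f m) [ f m ]) ⟨
    length (filter P? (applyUpTo f m ∷ʳ f m))
      ≡⟨ cong (length ∘ filter P?) (applyUpTo-∷ʳ f m) ⟩
    length (filter P? (f 0 ∷ applyUpTo (f ∘ suc) m))
      ≡⟨ cong length (filter-++ P? [ f 0 ] _) ⟩
    length (filter P? [ f 0 ] ++ filter P? (applyUpTo (f ∘ suc) m))
      ≡⟨ length-++-comm (filter P? [ f 0 ]) _ ⟩
    length (filter P? (applyUpTo (f ∘ suc) m) ++ filter P? [ f 0 ])
      ≡⟨ length-++ (filter P? (applyUpTo (f ∘ suc) m)) ⟩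
    count (f ∘ suc) m + length (filter P? [ f 0 ])
      ≡⟨ cong (count (f ∘ suc) m ℕ.+_) ends ⟩
    count (f ∘ suc) m + length (filter P? [ f m ]) ∎)
    where
    open ≡-Reasoning
    ends : length (filter P? [ f 0 ]) ≡ length (filter P? [ f m ])
    ends with P? (f 0) | P? (f m)
    ... | yes _  | yes _  = refl
    ... | no _   | no _   = refl
    ... | yes P₀ | no ¬Pₘ = contradiction (to P₀⇔Pₘ P₀) ¬Pₘ
    ... | no ¬P₀ | yes Pₘ = contradiction (from P₀⇔Pₘ Pₘ) ¬P₀

  count-periodic : ∀ f m → (∀ k → f k ∈ P ⇔ f (k + m) ∈ P) →
    ∀ d → count f m ≡ count (λ k → f (d + k)) m
  count-periodic f m periodic zero    = refl
  count-periodic f m periodic (suc d) =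
    trans (count-suc f m (periodic 0)) (count-periodic (f ∘ suc) m (periodic ∘ suc) d)

Interval : ℕ → ℕ → Pred ℕ 0ℓ
Interval u n x = u ≤ x × x ℕ.< u + n

interval-HasCardinality : (P? : Decidable P) → ∀ u n →
  HasCardinality (λ x → Interval u n x × x ∈ P) (count P? (u ℕ.+_) n)
interval-HasCardinality P? u n =
  HasCardinality-resp-≐
    ( (λ (x∈ , Px) → list⇒interval (∈-applyUpTo⁻ (u ℕ.+_) x∈) , Px)
    , (λ (x∈ , Px) → interval⇒list x∈ , Px))
    (filter-HasCardinality P? (applyUpTo (u ℕ.+_) n)
      (Unique.applyUpTo⁺₁ (u ℕ.+_) n λ i<j _ → <⇒≢ (+-monoʳ-< u i<j)))
  where
  list⇒interval : ∀ {x} → ∃[ k ] (k ℕ.< n × x ≡ u + k) → Interval u n x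
  list⇒interval (k , k<n , refl) = m≤m+n u k , +-monoʳ-< u k<n
  interval⇒list : ∀ {x} → Interval u n x → x List.∈ applyUpTo (u ℕ.+_) n
  interval⇒list (u≤x , x<u+n) with k , refl ← m≤n⇒∃[o]m+o≡n u≤x =
    ∈-applyUpTo⁺ (u ℕ.+_) (+-cancelˡ-< u k n x<u+n)

-- Periodicity of submonoids of ℕ

-- The maximum of finitely many thresholds works for all of them; here the indices `r` will be the
-- residues modulo `m`.
eventually-uniform : (R : ℕ → ℕ → Set) →
  (∀ r → ∃[ K ] ∀ k → K ≤ k → R r k) →
  ∀ n → ∃[ K ] ∀ r → r ℕ.< n → ∀ k → K ≤ k → R r k
eventually-uniform R eventually zero    = 0 , λ _ ()
eventually-uniform R eventually (suc n)
  with K , h ← eventually-uniform R eventually n | K′ , h′ ← eventually n =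
  K ⊔ K′ , λ r r<1+n k K⊔K′≤k → [
    (λ r<n → h r r<n k (≤-trans (m≤m⊔n K K′) K⊔K′≤k)) ,
    (λ { refl → h′ k (≤-trans (m≤n⊔m K K′) K⊔K′≤k) }) ]′ (m<1+n⇒m<n∨m≡n r<1+n)

module _ {T : Pred ℕ 0ℓ} (+-closed : ∀ {x y} → x ∈ T → y ∈ T → x + y ∈ T) where

  +-*-closed : ∀ {x} → x ∈ T → m ∈ T → ∀ k → x + k * m ∈ T
  +-*-closed x∈T m∈T zero = subst T (sym (+-identityʳ _)) x∈T
  +-*-closed {m} {x} x∈T m∈T (suc k) =
    subst T (+-assoc x m (k * m)) (+-*-closed (+-closed x∈T m∈T) m∈T k)

  -- A residue class modulo m either misses T or lies in T from its first
  -- element of T onwards.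
  class-eventually-periodic : ExcludedMiddle 0ℓ → m ∈ T →
    ∀ r → ∃[ K ] ∀ k → K ≤ k → r + suc k * m ∈ T → r + k * m ∈ T
  class-eventually-periodic {m} em m∈T r with em {∃[ k ] r + k * m ∈ T}
  ... | no ∄  = 0 , λ k _ ∈T → contradiction (suc k , ∈T) ∄
  ... | yes (K , ∈T) = K , λ k K≤k _ → above k (m≤n⇒∃[o]m+o≡n K≤k)
    where
    above : ∀ k → ∃[ j ] K + j ≡ k → r + k * m ∈ T
    above _ (j , refl) = subst T
      (trans (+-assoc r (K * m) (j * m)) (cong (r ℕ.+_) (sym (*-distribʳ-+ m K j))))
      (+-*-closed ∈T m∈T j)

  eventually-periodic : ExcludedMiddle 0ℓ → .{{_ : NonZero m}} → m ∈ T →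
    ∃[ N ] ∀ x → N ≤ x → x + m ∈ T → x ∈ T
  eventually-periodic {m} em m∈T
    with K , h ← eventually-uniform (λ r k → r + suc k * m ∈ T → r + k * m ∈ T)
           (class-eventually-periodic em m∈T) m =
    -- For `x` at least `K * m` the quotient `x / m` is at least `K`, the threshold common to all
    -- residue classes.
    K * m , λ x Km≤x x+m∈T →
      let r = x % m; k = x / m
          x≡ = m≡m%n+[m/n]*n x m
          x+m≡ : x + m ≡ r + suc k * m
          x+m≡ = begin
            x + m              ≡⟨ cong (_+ m) x≡ ⟩
            r + k * m + m      ≡⟨ +-assoc r (k * m) m ⟩
            r + (k * m + m)    ≡⟨ cong (r ℕ.+_) (+-comm (k * m) m) ⟩
            r + suc k * m      ∎
      in subst T (sym x≡) (h r (m%n<n x m) k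
           (subst (_≤ k) (m*n/n≡m K m) (/-monoˡ-≤ m Km≤x)) (subst T x+m≡ x+m∈T))
    where
    open ≡-Reasoning

-- Pseudo-Frobenius numbers of truncations

PF-resp-≐ : P ≐ Q → PF P ≐ PF Q
PF-resp-≐ (P⊆Q , Q⊆P) =
  (λ (x∉ , h) → x∉ ∘ Q⊆P , λ s s∈ s≢0 → P⊆Q (h s (Q⊆P s∈) s≢0)) ,
  (λ (x∉ , h) → x∉ ∘ P⊆Q , λ s s∈ s≢0 → Q⊆P (h s (P⊆Q s∈) s≢0))

module Truncation
  {T : Pred ℕ 0ℓ} {m N : ℕ}
  (em : ExcludedMiddle 0ℓ)
  (+-closed : ∀ {x y} → x ∈ T → y ∈ T → x + y ∈ T)
  (multiplicity : IsMultiplicity T m)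
  (periodic : ∀ x → N ≤ x → x + m ∈ T → x ∈ T)
  where

  open IsMultiplicity multiplicity renaming (m∈S to m∈T)

  ∉T? : Decidable (∁ T)
  ∉T? _ = em

  PF-bounded : ∀ {x} → x ∈ PF T → x ℕ.< N
  PF-bounded (x∉T , h) = ≰⇒> λ N≤x → x∉T (periodic _ N≤x (h m m∈T m≢0))

  -- The parameter `d` places the window: it starts at `N + d`, which is `F + 1 - m`, and ends at
  -- `F`. A gap of `T` in the window passes `F` when any nonzero element is added; below the window
  -- only the pseudo-Frobenius numbers of `T` survive.
  PF-truncation : ∀ {F} d → suc F ≡ N + d + m → N ℕ.< d →
    PF (T ∪ (F ℕ.<_)) ≐ PF T ∪ (λ x → Interval (N + d) m x × x ∉ T)
  PF-truncation {F} d F≡ N<d = ⇒ , [ ⇐ˡ , ⇐ʳ ]′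
    where
    ⇒ : PF (T ∪ (F ℕ.<_)) ⊆ PF T ∪ (λ x → Interval (N + d) m x × x ∉ T)
    ⇒ {x} (x∉ , h) with N + d ≤? x
    ... | yes u≤x = inj₂ ((u≤x , subst (x ℕ.<_) F≡ (s≤s (≮⇒≥ (x∉ ∘ inj₂)))) , x∉ ∘ inj₁)
    ... | no  u≰x = inj₁ (x∉ ∘ inj₁ , x+s∈T)
      where
      -- Below the window `x + m` is at most `F`, so it can only belong to the truncation through
      -- `T`.
      x+m∈T : x + m ∈ T
      x+m∈T with h m (inj₁ m∈T) m≢0
      ... | inj₁ ∈T  = ∈T
      ... | inj₂ F<x+m = contradiction
        (subst (_≤ x + m) F≡ F<x+m) (<⇒≱ (+-monoˡ-< m (≰⇒> u≰x)))
      x<N : x ℕ.< N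
      x<N = ≰⇒> λ N≤x → x∉ (inj₁ (periodic x N≤x x+m∈T))
      -- For large s, one period moves from s to x.
      x+s∈T : ∀ s → s ∈ T → s ≢ 0 → x + s ∈ T
      x+s∈T s s∈T s≢0 with h s (inj₁ s∈T) s≢0
      ... | inj₁ ∈T = ∈T
      ... | inj₂ F<x+s = subst T eq (+-closed x+m∈T s′∈T)
        where
        open ≤-Reasoning
        d+m≤s : d + m ≤ s
        d+m≤s = +-cancelˡ-≤ N _ _ (begin
          N + (d + m) ≡⟨ +-assoc N d m ⟨
          N + d + m   ≡⟨ F≡ ⟨
          suc F       ≤⟨ F<x+s ⟩
          x + s       ≤⟨ +-monoˡ-≤ s (<⇒≤ x<N) ⟩
          N + s       ∎)
        s′ = s ∸ m
        s≡ : s′ + m ≡ s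
        s≡ = m∸n+n≡m (≤-trans (m≤n+m m d) d+m≤s)
        s′∈T : s′ ∈ T
        -- Here `N<d` enters: `s′` is at least `d`, hence beyond the threshold `N`, and periodicity
        -- descends from `s` to `s′`.
        s′∈T = periodic s′ (≤-trans (<⇒≤ N<d) (m+n≤o⇒m≤o∸n d d+m≤s)) (subst T (sym s≡) s∈T)
        eq : x + m + s′ ≡ x + s
        eq = trans (+-assoc x m s′) (cong (x ℕ.+_) (trans (+-comm m s′) s≡))

    ⇐ˡ : PF T ⊆ PF (T ∪ (F ℕ.<_))
    ⇐ˡ {x} x∈PF@(x∉T , h) = [ x∉T , <⇒≱ (PF-bounded x∈PF) ∘ N≤x ]′ , x+s∈
      where
      N≤x : F ℕ.< x → N ≤ x
      N≤x F<x = ≤-trans (≤-trans (≤-trans (m≤m+n N d) (m≤m+n (N + d) m)) (≤-reflexive (sym F≡))) F<x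
      x+s∈ : ∀ s → s ∈ T ∪ (F ℕ.<_) → s ≢ 0 → x + s ∈ T ∪ (F ℕ.<_)
      x+s∈ s (inj₁ s∈T) s≢0 = inj₁ (h s s∈T s≢0)
      x+s∈ s (inj₂ F<s) s≢0 = inj₂ (≤-trans F<s (m≤n+m s x))

    ⇐ʳ : ∀ {x} → Interval (N + d) m x × x ∉ T → x ∈ PF (T ∪ (F ℕ.<_))
    ⇐ʳ {x} ((u≤x , x<u+m) , x∉T) = [ x∉T , x≯F ]′ , λ s s∈ s≢0 → inj₂ (F<x+s s s∈ s≢0)
      where
      x≯F : ¬ F ℕ.< x
      x≯F F<x = <⇒≱ x<u+m (subst (_≤ x) F≡ F<x)
      F<x+s : ∀ s → s ∈ T ∪ (F ℕ.<_) → s ≢ 0 → F ℕ.< x + s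
      -- A nonzero `s` in `T` is at least `m`, so `x + s` reaches `N + d + m`, which is `F + 1`.
      F<x+s s (inj₁ s∈T) s≢0 = subst (_≤ x + s) (sym F≡) (+-mono-≤ u≤x (least s s∈T s≢0))
      F<x+s s (inj₂ F<s) s≢0 = ≤-trans F<s (m≤n+m s x)

  PF-finite : Finite (PF T)
  PF-finite = ⊆-finite (λ _ → em) (∈-upTo⁺ ∘ PF-bounded)
    (_ , upTo N , Unique.upTo⁺ N , refl , λ _ → mk⇔ id id)

  -- The window at `N + d` is a translate of the one at `N`, so by periodicity the count at `N`
  -- serves for every `F`. The lower bound on `F` makes `d` exceed `N`.
  type-truncation : ∃[ t ] ∀ F → N + suc N + m ≤ F → HasType (T ∪ (F ℕ.<_)) t
  type-truncation = proj₁ PF-finite + count ∉T? (N ℕ.+_) m , λ F bound →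
    let d  = suc F ∸ m ∸ N
        N+[1+N]≤ = m+n≤o⇒m≤o∸n (N + suc N) (m≤n⇒m≤1+n bound)
        F≡ : suc F ≡ N + d + m
        F≡ = sym (trans (cong (_+ m) (m+[n∸m]≡n (m+n≤o⇒m≤o N N+[1+N]≤)))
                        (m∸n+n≡m (m+n≤o⇒n≤o (N + suc N) (m≤n⇒m≤1+n bound))))
        N<d = m+n≤o⇒m≤o∸n (suc N) (subst (_≤ suc F ∸ m) (+-comm N (suc N)) N+[1+N]≤)
        PF≐ = PF-truncation d F≡ N<d
    in HasCardinality-resp-≐ (swap PF≐)
         (HasCardinality-∪ (λ x∈PF ((u≤x , _) , _) → <⇒≱ (PF-bounded x∈PF) (≤-trans (m≤m+n N d) u≤x))
           (proj₂ PF-finite)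
           (subst (HasCardinality _) (sym (window d)) (interval-HasCardinality ∉T? (N + d) m)))
    where
    shift : ∀ k → N + k ∉ T ⇔ N + (k + m) ∉ T
    shift k = mk⇔
      (λ ∉T ∈T → ∉T (periodic (N + k) (m≤m+n N k) (subst T (sym (+-assoc N k m)) ∈T)))
      (λ ∉T ∈T → ∉T (subst T (+-assoc N k m) (+-closed ∈T m∈T)))
    window : ∀ d → count ∉T? (N ℕ.+_) m ≡ count ∉T? ((N + d) ℕ.+_) m
    window d = trans (count-periodic ∉T? (N ℕ.+_) m shift d)
      (count-cong ∉T? (λ k → sym (+-assoc N d k)) m)

-- Sequences of iterated Frobenius removals

largest-gap : ∀ {f} → IsFrobenius P (+ f) → f ∉ P × (∀ x → x ∉ P → x ≤ f)
largest-gap (largestGap f∉P max) = f∉P , max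

finite-type : ExcludedMiddle 0ℓ → IsNumericalSemigroup P → ∃[ t ] HasType P t
finite-type em semigroup =
  ⊆-finite (λ _ → em) proj₁ (IsNumericalSemigroup.cofinite semigroup)

module FrobeniusSequence
  (em : ExcludedMiddle 0ℓ)
  (S : ℕ → Pred ℕ 0ℓ)
  (step : ∀ i → ∃[ f ] IsFrobenius (S (suc i)) (+ f) × S i ≐ (S (suc i) ∪ ｛ f ｝))
  where

  F : ℕ → ℕ
  F i = proj₁ (step i)

  F∉S : ∀ i → F i ∉ S (suc i)
  F∉S i = proj₁ (largest-gap (proj₁ (proj₂ (step i))))

  gap≤F : ∀ i {x} → x ∉ S (suc i) → x ≤ F i
  gap≤F i = proj₂ (largest-gap (proj₁ (proj₂ (step i)))) _

  S-suc : ∀ i → S (suc i) ⊆ S i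
  S-suc i = proj₂ (proj₂ (proj₂ (step i))) ∘ inj₁

  F∈S : ∀ i → F i ∈ S i
  F∈S i = proj₂ (proj₂ (proj₂ (step i))) (inj₂ refl)

  ∈S-suc : ∀ i {x} → x ∈ S i → x ℕ.< F i → x ∈ S (suc i)
  ∈S-suc i x∈S x<F with proj₁ (proj₂ (proj₂ (step i))) x∈S
  ... | inj₁ x∈S′ = x∈S′
  ... | inj₂ refl = contradiction x<F (<-irrefl refl)

  S-antitone : ∀ k i → S (k + i) ⊆ S i
  S-antitone zero    i = id
  S-antitone (suc k) i = S-antitone k i ∘ S-suc (k + i)

  -- A gap of `S (suc i)` remains a gap of the smaller `S (suc (suc i))`, which gives the weak
  -- inequality. Equality fails because `F (suc i)` lies in `S (suc i)` and `F i` does not.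
  F-suc : ∀ i → F i ℕ.< F (suc i)
  F-suc i = ≤∧≢⇒< (gap≤F (suc i) (F∉S i ∘ S-suc (suc i)))
    λ F≡ → F∉S i (subst (S (suc i)) (sym F≡) (F∈S (suc i)))

  i≤F : ∀ i → i ≤ F i
  i≤F zero    = z≤n
  i≤F (suc i) = ≤-<-trans (i≤F i) (F-suc i)

  limit : Pred ℕ 0ℓ
  limit = ⋂ ℕ S

  -- From stage `i` on, the numbers removed are `F i` and larger ones, so `x` is never removed;
  -- earlier terms contain `S i`.
  ∈limit : ∀ i {x} → x ∈ S i → x ℕ.< F i → x ∈ limit
  ∈limit i {x} x∈S x<F j with ≤-total j i
  ... | inj₁ j≤i = S-antitone (i ∸ j) j (subst (λ l → x ∈ S l) (sym (m∸n+n≡m j≤i)) x∈S)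
  ... | inj₂ i≤j = subst (λ l → x ∈ S l) (m∸n+n≡m i≤j) (proj₁ (later (j ∸ i)))
    where
    later : ∀ k → x ∈ S (k + i) × x ℕ.< F (k + i)
    later zero    = x∈S , x<F
    later (suc k) with x∈ , x< ← later k = ∈S-suc (k + i) x∈ x< , <-trans x< (F-suc (k + i))

  S≐truncation : ∀ i → S (suc i) ≐ limit ∪ (F i ℕ.<_)
  S≐truncation i = ⇒ , [ (λ x∈ → x∈ (suc i)) , above ]′
    where
    ⇒ : S (suc i) ⊆ limit ∪ (F i ℕ.<_)
    ⇒ {x} x∈S with F i <? x
    ... | yes F<x = inj₂ F<x
    -- An element that is at most `F i` lies strictly below the next number to be removed,
    -- `F (suc i)`.
    ... | no  F≮x = inj₁ (∈limit (suc i) x∈S (≤-<-trans (≮⇒≥ F≮x) (F-suc i)))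
    above : ∀ {x} → F i ℕ.< x → x ∈ S (suc i)
    above {x} F<x with em {x ∈ S (suc i)}
    ... | yes x∈S = x∈S
    ... | no  x∉S = contradiction (gap≤F i x∉S) (<⇒≱ F<x)

theorem1p5 : ExcludedMiddle 0ℓ →
    (S : ℕ → Pred ℕ 0ℓ) →
    (∀ i → IsNumericalSemigroup (S i)) →
    (∀ i → ∃[ f ] IsFrobenius (S (suc i)) (+ f) × S i ≐ (S (suc i) ∪ ｛ f ｝)) →
    (∃[ i ] ∃[ m ] ∃[ f ] IsMultiplicity (S i) m × IsFrobenius (S i) f × + m < f) →
    ∃[ t ] (∀ i → HasType (S i) (t i)) × EventuallyConstant t
theorem1p5 em S semigroup step
  (i₀ , m , _ , multiplicity , largestGap {f} f∉S _ , +<+ m<f) =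
  proj₁ ∘ type , proj₂ ∘ type , suc bound , λ n n>bound →
    trans (type-value n n>bound) (sym (type-value (suc bound) ≤-refl))
  where
  open FrobeniusSequence em S step
  open IsMultiplicity multiplicity

  limit-+-closed : ∀ {x y} → x ∈ limit → y ∈ limit → x + y ∈ limit
  limit-+-closed x∈ y∈ i = IsNumericalSemigroup.+-closed (semigroup i) (x∈ i) (y∈ i)

  m∈limit : m ∈ limit
  -- The gap `f` of `S i₀` is also a gap of `S (suc i₀)`, hence at most `F i₀`; so `m` is below
  -- every number still to be removed.
  m∈limit = ∈limit i₀ m∈S (<-≤-trans m<f (gap≤F i₀ (f∉S ∘ S-suc i₀)))

  limit-multiplicity : IsMultiplicity limit m
  limit-multiplicity = record
    { m∈S = m∈limit ; m≢0 = m≢0 ; least = λ s s∈ → least s (s∈ i₀) }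

  limit-periodic : ∃[ N ] ∀ x → N ≤ x → x + m ∈ limit → x ∈ limit
  limit-periodic = eventually-periodic limit-+-closed em {{≢-nonZero m≢0}} m∈limit

  open Truncation em limit-+-closed limit-multiplicity (proj₂ limit-periodic)

  type : ∀ i → ∃[ t ] HasType (S i) t
  type i = finite-type em (semigroup i)

  bound : ℕ
  bound = proj₁ limit-periodic + suc (proj₁ limit-periodic) + m

  -- Since `F i` is at least `i`, an index past `bound` pushes the Frobenius number past it too. The
  -- successor appears because `F i` belongs to `S (suc i)`.
  type-value : ∀ n → n ≥ suc bound → proj₁ (type n) ≡ proj₁ type-truncation
  type-value (suc i) (s≤s bound≤i) = HasCardinality-unique (proj₂ (type (suc i)))
    (HasCardinality-resp-≐ (swap (PF-resp-≐ (S≐truncation i)))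
      (proj₂ type-truncation (F i) (≤-trans bound≤i (i≤F i))))
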